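{- Let $H$ be the collision history of $n$ objects $V=\{v_1,\dots,v_n\}$ moving along the real line, viewed as an edge-labeled multigraph on $V$, with collisions $e_1,\dots,e_m$ in order of time. Then the positions $p_k$ for all $k\in\{0,1,\dots,m\}$ are uniquely determined by $H$ (up to inversion) if and only if $H$ is connected.
   Context: Model: each object $v_i\in V$ has a continuous trajectory $v_i(t):\mathbb{R}\to\mathbb{R}$, not known a priori. A collision $v_iv_j$ (for $i\ne j$) occurs at time $t$ if $v_i(t)=v_j(t)$. It is assumed that: (1) collisions are instantaneous (two trajectories meet at isolated times and do not overlap on a time interval); (2) at most one pair of trajectories collides at any time $t$ (in particular, no three trajectories meet at the same time); (3) trajectories cross at every collision, i.e. if $v_i,v_j$ collide at $t$ then $v_i(t^-)<v_j(t^-)$ implies $v_i(t^+)>v_j(t^+)$. History: the collision history is the finite sequence $h=e_1,e_2,\dots,e_m$ of collisions, where $e_k$ is the (unordered) pair of objects involved in the $k$-th collision in time order. Equivalently, it is the multigraph $H=(V,E=\{e_i\})$ on vertex set $V$ whose edges are labeled by their order in the sequence. Only $H$ is observed (not the trajectories or the actual times). Positions: $p_k=(v_{i_1},v_{i_2},\dots,v_{i_n})$ is the ordering of $V$ with $v_{i_1}(t)<v_{i_2}(t)<\cdots<v_{i_n}(t)$ for all $t$ between the $k$-th and $(k+1)$-th collision ($p_0$ is the ordering before the first collision, $p_m$ the ordering after the last). Uniqueness: replacing all $v_i(t)$ by $-v_i(t)$ gives the same history with all $p_k$ reversed, so uniqueness is always understood up to inversion: "there are unique $p_k$ for all $k$"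 means that any two families of trajectories satisfying the model and having the same history $H$ have the same sequence $(p_0,\dots,p_m)$, up to simultaneously reversing all the $p_k$.
   Formalization: The case of n = 2 objects with no collisions (m = 0) is excluded: there H is disconnected, yet the only two orderings are inversions of each other, so the positions are unique up to inversion and the stated equivalence fails. -}

module Defs where

open import Algebra.Structures using (IsCommutativeRing)
open import Data.Fin as Fin using (Fin; toℕ)
open import Data.Fin.Permutation as Perm
  using (Permutation′; _⟨$⟩ʳ_; _∘ₚ_; reverse)
open import Data.Nat as ℕ using (ℕ; suc)
open import Data.Product using (∃; _×_)
open import Data.Sum using (_⊎_)
open import Data.Vec.Functional using (Vector)
open import Function.Bundles using (_⇔_)
open import Level using (0ℓ)
open import Relation.Binary using (Rel; IsStrictTotalOrder)
open import Relation.Binary.Construct.Closure.ReflexiveTransitive using (Star)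
open import Relation.Binary.PropositionalEquality using (_≡_; _≢_)
open import Relation.Nullary using (¬_)
open import Relation.Unary using (Pred)

-- The real numbers, given by their classical characterisation as the Dedekind
-- complete ordered field.  The order is trichotomous, and least upper bounds
-- exist for all inhabited bounded predicates.

record CompleteOrderedField : Set₁ where
  infix  4 _≈_ _<_ _≤_
  infixl 6 _+_ _-_
  infixl 7 _*_
  infix  8 -_
  field
    Carrier            : Set
    _≈_ _<_            : Rel Carrier 0ℓ
    _+_ _*_            : Carrier → Carrier → Carrier
    -_                 : Carrier → Carrier
    0# 1#              : Carrier
    isCommutativeRing  : IsCommutativeRing _≈_ _+_ _*_ -_ 0# 1#
    0≉1                : ¬ (0# ≈ 1#)
    inverse            : ∀ x → ¬ (x ≈ 0#) → ∃ λ y → x * y ≈ 1#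
    isStrictTotalOrder : IsStrictTotalOrder _≈_ _<_
    +-monoʳ-<          : ∀ x {y z} → y < z → x + y < x + z
    *-pos              : ∀ {x y} → 0# < x → 0# < y → 0# < x * y

  _-_ : Carrier → Carrier → Carrier
  x - y = x + (- y)

  _≤_ : Rel Carrier 0ℓ
  x ≤ y = x < y ⊎ x ≈ y

  UpperBound : Pred Carrier 0ℓ → Pred Carrier 0ℓ
  UpperBound P b = ∀ x → P x → x ≤ b

  field
    supremum : (P : Pred Carrier 0ℓ) → ∃ P → ∃ (UpperBound P) →
               ∃ λ s → UpperBound P s × (∀ b → UpperBound P b → s ≤ b)

  -- |x - y| < ε
  Within : Carrier → Rel Carrier 0ℓ
  Within ε x y = x - y < ε × y - x < ε

  -- Functions are not required to respect _≈_: continuity implies it.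
  Continuous : Pred (Carrier → Carrier) 0ℓ
  Continuous f = ∀ t ε → 0# < ε →
    ∃ λ δ → 0# < δ × (∀ s → Within δ s t → Within ε (f s) (f t))

-- An unordered pair of distinct objects, represented by its increasing listing.

record Edge (n : ℕ) : Set where
  constructor edge
  field
    lo hi : Fin n
    lo<hi : lo Fin.< hi

Joins : ∀ {n} → Edge n → Rel (Fin n) 0ℓ
Joins e i j = (i ≡ lo × j ≡ hi) ⊎ (i ≡ hi × j ≡ lo)
  where open Edge e

-- A multigraph on n vertices with m edges labelled by their order.

History : ℕ → ℕ → Set
History n m = Vector (Edge n) m

Adjacent : ∀ {n m} → History n m → Rel (Fin n) 0ℓ
Adjacent h i j = ∃ λ k → Joins (h k) i j

Connected : ∀ {n m} → History n m → Set
Connected h = ∀ i j → Star (Adjacent h) i j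

-- p k sends each place, counted from the left, to the object occupying it.

Positions : ℕ → ℕ → Set
Positions n m = Fin (suc m) → Permutation′ n

EqualUpToInversion : ∀ {n m} → Rel (Positions n m) 0ℓ
EqualUpToInversion p q =
  (∀ k → p k Perm.≈ q k) ⊎ (∀ k → p k Perm.≈ reverse ∘ₚ q k)

module Motion (ℝ : CompleteOrderedField) where
  open CompleteOrderedField ℝ renaming (Carrier to R)

  module _ {n : ℕ} (v : Fin n → R → R) where

    Collide : Fin n → Fin n → Pred R 0ℓ
    Collide i j t = i ≢ j × v i t ≈ v j t

    -- v_i(t⁻) < v_j(t⁻)
    LessBefore : Fin n → Fin n → Pred R 0ℓ
    LessBefore i j t =
      ∃ λ ε → 0# < ε × (∀ s → t - ε < s → s < t → v i s < v j s)

    -- v_i(t⁺) < v_j(t⁺)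
    LessAfter : Fin n → Fin n → Pred R 0ℓ
    LessAfter i j t =
      ∃ λ ε → 0# < ε × (∀ s → t < s → s < t + ε → v i s < v j s)

    record IsTrajectoryFamily : Set where
      field
        continuous    : ∀ i → Continuous (v i)
        instantaneous : ∀ i j t → Collide i j t →
          ∃ λ ε → 0# < ε ×
            (∀ s → Within ε s t → ¬ (s ≈ t) → ¬ Collide i j s)
        onePair       : ∀ i j k l t → Collide i j t → Collide k l t →
          (i ≡ k × j ≡ l) ⊎ (i ≡ l × j ≡ k)
        crossing      : ∀ i j t → Collide i j t →
          LessBefore i j t → LessAfter j i t

    record HasHistory {m : ℕ} (h : History n m) : Set where
      field
        time       : Fin m → R
        increasing : ∀ {k l} → k Fin.< l → time k < time l
        collisions : ∀ i j t →
          Collide i j t ⇔ (∃ λ k → t ≈ time k × Joins (h k) i j)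

      -- t lies after the first k collisions and before all later ones; since
      -- indices start at 0, those first k are the ones with index below k.
      Between : Fin (suc m) → Pred R 0ℓ
      Between k t = ∀ (l : Fin m) →
        (toℕ l ℕ.< toℕ k → time l < t) × (toℕ k ℕ.≤ toℕ l → t < time l)

      HasPositions : Positions n m → Set
      HasPositions p = ∀ k t → Between k t → ∀ {a b} → a Fin.< b →
        v (p k ⟨$⟩ʳ a) t < v (p k ⟨$⟩ʳ b) t

  IsCollisionHistory : ∀ {n m} → History n m → Set
  IsCollisionHistory {n} h =
    ∃ λ (v : Fin n → R → R) → IsTrajectoryFamily v × HasHistory v h

  UniquePositions : ∀ {n m} → History n m → Set
  UniquePositions {n} {m} h =
    ∀ (v w : Fin n → R → R) → IsTrajectoryFamily v → IsTrajectoryFamily w →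
    (hv : HasHistory v h) (hw : HasHistory w h) (p q : Positions n m) →
    HasHistory.HasPositions hv p → HasHistory.HasPositions hw q →
    EqualUpToInversion p q

-- Two objects that never collide form a disconnected history, yet their only
-- two orderings are inversions of each other, so the positions are unique.

TwoWithoutCollision : ℕ → ℕ → Set
TwoWithoutCollision n m = n ≡ 2 × m ≡ 0

{-# OPTIONS --safe #-}

-- Call a pair of objects reversed if two families with history h order it
-- differently.  By the intermediate value theorem a collision flips the order of
-- the colliding pair in both families and of no other pair, so being reversed does
-- not depend on time.  Just before a and b collide they are neighbours, so any third
-- object c is on the same side of both: {a,c} is reversed iff {b,c} is.  If h is
-- connected, moving one member of a pair at a time along edges takes any pair to any
-- other, so all pairs are reversed or none is.
--
-- If h is disconnected, lift one class of a partition respecting all edges above the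
-- remaining objects, or below them, by subtracting a continuous strict lower
-- (respectively upper) bound of all trajectories.  The two resulting families order
-- objects of different classes oppositely, and objects of the same class alike; such
-- objects exist unless n = 2 and m = 0.

module Submission where

open import Defs
open import Algebra.Bundles using (CommutativeRing)
import Algebra.Construct.NaturalChoice.Max as Max
import Algebra.Properties.AbelianGroup as AbelianGroupProperties
import Algebra.Properties.CommutativeSemigroup as CommutativeSemigroupProperties
open import Data.Bool using (Bool; true; false; not; _xor_; if_then_else_)
open import Data.Bool.Properties using (xor-annihilates-not)
open import Data.Empty using (⊥; ⊥-elim)
open import Data.Fin as Fin using (Fin; zero; suc; toℕ; inject₁; opposite; punchIn)
open import Data.Fin.Induction using (<-weakInduction)
open import Data.Fin.Permutation as Perm using (Permutation′; _⟨$⟩ʳ_; _⟨$⟩ˡ_; _∘ₚ_; reverse)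
import Data.Fin.Properties as FinP
open import Data.Nat as ℕ using (ℕ; zero; suc; z≤n; s≤s)
import Data.Nat.Properties as ℕP
open import Data.Product using (∃; ∃₂; _×_; _,_; proj₁; proj₂)
open import Data.Sum as Sum using (_⊎_; inj₁; inj₂)
open import Function using (_∘_; id)
open import Function.Bundles using (_⇔_; mk⇔; Equivalence)
open import Level using (0ℓ)
open import Relation.Binary using (Rel; Asymmetric; StrictTotalOrder; Tri; tri<; tri≈; tri>)
open import Relation.Binary.Construct.Closure.ReflexiveTransitive as Star using (Star; _◅_; _◅◅_)
import Relation.Binary.Construct.StrictToNonStrict as StrictToNonStrict
import Relation.Binary.Properties.StrictTotalOrder as StrictTotalOrderProperties
open import Relation.Binary.PropositionalEquality using (_≡_; _≢_; refl; sym; trans; cong; cong₂; subst; subst₂; ≢-sym)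
open import Relation.Nullary using (¬_; Dec; yes; no; does; contradiction; ¬?)
open import Relation.Nullary.Decidable using (does-⇔; dec-true; dec-false; _×-dec_; _⊎-dec_)
open import Relation.Unary using (Pred)

-- Sorting permutations

Sorts : ∀ {n ℓ} → Rel (Fin n) ℓ → Permutation′ n → Set ℓ
Sorts _≺_ π = ∀ {a b} → a Fin.< b → (π ⟨$⟩ʳ a) ≺ (π ⟨$⟩ʳ b)

-- Each step to the next index raises the value by at least one, starting from at least zero.
increasing⇒inflationary : ∀ {n} (f : Fin n → Fin n) →
  (∀ {a b} → a Fin.< b → f a Fin.< f b) → ∀ i → i Fin.≤ f i
increasing⇒inflationary {suc n} f f-mono = <-weakInduction _ z≤n step
  where
  step : ∀ i → inject₁ i Fin.≤ f (inject₁ i) → suc i Fin.≤ f (suc i)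
  step i i≤fi = ℕP.≤-trans
    (s≤s (subst (ℕ._≤ toℕ (f (inject₁ i))) (FinP.toℕ-inject₁ i) i≤fi))
    (f-mono (s≤s (ℕP.≤-reflexive (FinP.toℕ-inject₁ i))))

module _ {n ℓ} {_≺_ : Rel (Fin n) ℓ} (asym : Asymmetric _≺_) where

  sorts-reflects : ∀ ρ → Sorts _≺_ ρ → ∀ {a b} →
    (ρ ⟨$⟩ʳ a) ≺ (ρ ⟨$⟩ʳ b) → a Fin.< b
  sorts-reflects ρ ρ-sorts {a} {b} ρa≺ρb with FinP.<-cmp a b
  ... | tri< a<b _ _  = a<b
  ... | tri≈ _ refl _ = ⊥-elim (asym ρa≺ρb ρa≺ρb)
  ... | tri> _ _ b<a  = ⊥-elim (asym ρa≺ρb (ρ-sorts b<a))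

  -- Sending a place under `π` to the place of the same object under `ρ` is strictly increasing,
  -- hence inflationary.
  sorts-≤ : ∀ π ρ → Sorts _≺_ π → Sorts _≺_ ρ →
    ∀ i → i Fin.≤ (ρ ⟨$⟩ˡ (π ⟨$⟩ʳ i))
  sorts-≤ π ρ π-sorts ρ-sorts = increasing⇒inflationary _ λ a<b →
    sorts-reflects ρ ρ-sorts
      (subst₂ _≺_ (sym (Perm.inverseʳ ρ)) (sym (Perm.inverseʳ ρ)) (π-sorts a<b))

  -- The change of places from `π` to `ρ` and its inverse are both inflationary, so both fix every
  -- place.
  sorts-unique : ∀ π ρ → Sorts _≺_ π → Sorts _≺_ ρ → π Perm.≈ ρ
  sorts-unique π ρ π-sorts ρ-sorts i =
    trans (sym (Perm.inverseʳ ρ)) (cong (ρ ⟨$⟩ʳ_) (sym (FinP.≤-antisym i≤j j≤i)))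
    where
    j = ρ ⟨$⟩ˡ (π ⟨$⟩ʳ i)
    i≤j = sorts-≤ π ρ π-sorts ρ-sorts i
    j≤i = subst (j Fin.≤_)
      (trans (cong (π ⟨$⟩ˡ_) (Perm.inverseʳ ρ)) (Perm.inverseˡ π))
      (sorts-≤ ρ π ρ-sorts π-sorts j)

opposite-anti-< : ∀ {n} {a b : Fin n} → a Fin.< b → opposite b Fin.< opposite a
opposite-anti-< {n} {a} {b} a<b = subst₂ ℕ._<_
  (sym (FinP.opposite-prop b)) (sym (FinP.opposite-prop a))
  (ℕP.∸-monoʳ-< (s≤s a<b) (FinP.toℕ<n b))

-- Existence of sorting permutations

module _ {c ℓ₁ ℓ₂} (O : StrictTotalOrder c ℓ₁ ℓ₂) where
  open StrictTotalOrder O using (Carrier; _≈_; _<_; _<?_; compare)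
    renaming (trans to <-trans; irrefl to <-irrefl; module Eq to ≈)

  minimal : ∀ {n} (f : Fin (suc n) → Carrier) → ∃ λ i → ∀ j → ¬ f j < f i
  minimal {zero}  f = zero , λ { zero → <-irrefl ≈.refl }
  minimal {suc n} f with minimal (f ∘ suc)
  ... | i , i-min with f zero <? f (suc i)
  ...   | yes f0<fi = zero , λ where
    zero    → <-irrefl ≈.refl
    (suc j) → λ fj<f0 → i-min j (<-trans fj<f0 f0<fi)
  ...   | no f0≮fi  = suc i , λ { zero → f0≮fi ; (suc j) → i-min j }

  -- Selection sort: a minimal entry `i` takes place zero, and `punchIn i` carries over the sorted
  -- remainder.
  sort : ∀ {n} (f : Fin n → Carrier) → (∀ i j → i ≢ j → ¬ f i ≈ f j) →
    ∃ λ π → Sorts (λ i j → f i < f j) π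
  sort {zero}  f f-inj = Perm.id , λ { {()} }
  sort {suc n} f f-inj with minimal f
  ... | i , i-min with sort (f ∘ punchIn i)
                         (λ j k j≢k → f-inj _ _ (j≢k ∘ FinP.punchIn-injective i j k))
  ...   | π , π-sorts = ρ , ρ-sorts
    where
    ρ = Perm.insert zero i π

    least : ∀ j → i ≢ j → f i < f j
    least j i≢j with compare (f i) (f j)
    ... | tri< fi<fj _ _ = fi<fj
    ... | tri≈ _ fi≈fj _ = contradiction fi≈fj (f-inj i j i≢j)
    ... | tri> _ _ fj<fi = contradiction fj<fi (i-min j)

    ρ-suc : ∀ a → punchIn i (π ⟨$⟩ʳ a) ≡ (ρ ⟨$⟩ʳ suc a)
    ρ-suc a = sym (Perm.insert-punchIn zero i π a)

    ρ-sorts : Sorts (λ j k → f j < f k) ρ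
    ρ-sorts {zero}  {suc b} _         =
      subst (λ j → f i < f j) (ρ-suc b) (least _ (≢-sym (FinP.punchInᵢ≢i i _)))
    ρ-sorts {suc a} {suc b} (s≤s a<b) =
      subst₂ (λ j k → f j < f k) (ρ-suc a) (ρ-suc b) (π-sorts a<b)

-- Connectivity

-- Two tokens on distinct vertices x and z: if x moves to y through z, the token
-- on z continues to y instead and the token on x takes its place.
module Slide {n} {A : Set} {Adj : Rel (Fin n) 0ℓ} (χ : Fin n → Fin n → A)
  (χ-sym : ∀ i j → i ≢ j → χ i j ≡ χ j i)
  (χ-slide : ∀ a b c → Adj a b → c ≢ a → c ≢ b → χ a c ≡ χ b c) where

  walk : ∀ {x y} → Star Adj x y → ∀ z → z ≢ x → z ≢ y → χ x z ≡ χ y z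
  walk         Star.ε              z z≢x z≢y = refl
  walk {x} {y} (_◅_ {j = u} e s) z z≢x z≢y with u FinP.≟ z
  ... | no u≢z   = trans (χ-slide x u z e z≢x (≢-sym u≢z)) (walk s z (≢-sym u≢z) z≢y)
  ... | yes refl with x FinP.≟ y
  ...   | yes refl = refl
  ...   | no x≢y   =
    trans (χ-sym x z (≢-sym z≢x)) (
    trans (walk s x (≢-sym z≢x) x≢y) (
    trans (χ-sym y x (≢-sym x≢y)) (
    trans (χ-slide x z y e (≢-sym x≢y) (≢-sym z≢y))
          (χ-sym z y z≢y))))

  module _ (conn : ∀ i j → Star Adj i j) where

    -- Move `i` to `k` while `j` rests, then `j` to `l` while `k` rests. If `k` is `j`, the first
    -- move would end on the resting token, so `i` goes to `l` instead and symmetry finishes.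
    constant : ∀ i j k l → i ≢ j → k ≢ l → χ i j ≡ χ k l
    constant i j k l i≢j k≢l with k FinP.≟ j
    ... | yes refl = trans (walk (conn i l) k (≢-sym i≢j) k≢l) (χ-sym l k (≢-sym k≢l))
    ... | no k≢j   =
      trans (walk (conn i k) j (≢-sym i≢j) (≢-sym k≢j)) (
      trans (χ-sym k j k≢j) (
      trans (walk (conn j l) k k≢j k≢l)
            (χ-sym l k (≢-sym k≢l))))

constantOffDiagonal : ∀ {n} (χ : Fin n → Fin n → Bool) →
  (∀ i j k l → i ≢ j → k ≢ l → χ i j ≡ χ k l) → ∃ λ b → ∀ i j → i ≢ j → χ i j ≡ b
-- With fewer than two vertices there are no off-diagonal entries, so the value is arbitrary.
constantOffDiagonal {zero}        χ const = false , λ ()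
constantOffDiagonal {suc zero}    χ const =
  false , λ { zero zero 0≢0 → contradiction refl 0≢0 }
constantOffDiagonal {suc (suc n)} χ const =
  χ zero (suc zero) , λ i j i≢j → const i j _ _ i≢j λ ()

Joins-sym : ∀ {n} (e : Edge n) {i j} → Joins e i j → Joins e j i
Joins-sym e (inj₁ (i≡lo , j≡hi)) = inj₂ (j≡hi , i≡lo)
Joins-sym e (inj₂ (i≡hi , j≡lo)) = inj₁ (j≡lo , i≡hi)

Joins-≢ : ∀ {n} (e : Edge n) {i j} → Joins e i j → i ≢ j
Joins-≢ e (inj₁ (refl , refl)) = FinP.<⇒≢ (Edge.lo<hi e)
Joins-≢ e (inj₂ (refl , refl)) = ≢-sym (FinP.<⇒≢ (Edge.lo<hi e))

Joins-unique : ∀ {n} (e : Edge n) {a b c} → Joins e a b → Joins e a c → b ≡ c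
Joins-unique e (inj₁ (refl , refl)) (inj₁ (_ , refl))  = refl
Joins-unique e (inj₁ (refl , refl)) (inj₂ (lo≡hi , _)) =
  contradiction lo≡hi (FinP.<⇒≢ (Edge.lo<hi e))
Joins-unique e (inj₂ (refl , refl)) (inj₁ (hi≡lo , _)) =
  contradiction (sym hi≡lo) (FinP.<⇒≢ (Edge.lo<hi e))
Joins-unique e (inj₂ (refl , refl)) (inj₂ (_ , refl))  = refl

Joins? : ∀ {n} (e : Edge n) i j → Dec (Joins e i j)
Joins? (edge lo hi _) i j =
  (i FinP.≟ lo ×-dec j FinP.≟ hi) ⊎-dec (i FinP.≟ hi ×-dec j FinP.≟ lo)

-- Two vertices have equal labels exactly when a path joins them, so comparing labels decides
-- reachability.
record ComponentLabels {n m} (h : History n m) : Set where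
  field
    label    : Fin n → Fin n
    joined   : ∀ k {i j} → Joins (h k) i j → label i ≡ label j
    walkable : ∀ i j → label i ≡ label j → Star (Adjacent h) i j

-- The edges are added one at a time, as in union-find: the first edge is added to a labelling for
-- the others by giving the class of one endpoint the label of the other.
componentLabels : ∀ {n m} (h : History n m) → ComponentLabels h
componentLabels {m = zero}  h = record
  { label = id ; joined = λ () ; walkable = λ { i .i refl → Star.ε } }
componentLabels {n} {suc m} h = record
  { label = merge ∘ label ; joined = joined′ ; walkable = walkable′ }
  where
  open ComponentLabels (componentLabels (h ∘ suc))
  open Edge (h zero) renaming (lo to a; hi to b)

  merge : Fin n → Fin n
  merge c = if does (c FinP.≟ label a) then label b else c

  merge-ab : merge (label a) ≡ merge (label b)
  merge-ab with label a FinP.≟ label a | label b FinP.≟ label a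
  ... | yes _   | yes _ = refl
  ... | yes _   | no _  = refl
  ... | no ¬refl | _    = contradiction refl ¬refl

  joined′ : ∀ k {i j} → Joins (h k) i j → merge (label i) ≡ merge (label j)
  joined′ zero    (inj₁ (refl , refl)) = merge-ab
  joined′ zero    (inj₂ (refl , refl)) = sym merge-ab
  joined′ (suc k) e                    = cong merge (joined k e)

  old : ∀ i j → label i ≡ label j → Star (Adjacent h) i j
  old i j eq = Star.map (λ (k , e) → suc k , e) (walkable i j eq)

  ab : Adjacent h a b
  ab = zero , inj₁ (refl , refl)

  ba : Adjacent h b a
  ba = zero , inj₂ (refl , refl)

  walkable′ : ∀ i j → merge (label i) ≡ merge (label j) → Star (Adjacent h) i j
  walkable′ i j eq with label i FinP.≟ label a | label j FinP.≟ label a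
  ... | yes i~a | yes j~a = old i j (trans i~a (sym j~a))
  ... | yes i~a | no _    = old i a i~a ◅◅ ab ◅ old b j eq
  ... | no _    | yes j~a = old i b eq ◅◅ ba ◅ old a j (sym j~a)
  ... | no _    | no _    = old i j eq

-- Ordered field

module Field (ℝ : CompleteOrderedField) where
  open CompleteOrderedField ℝ using
    ( isCommutativeRing; 0≉1; inverse; isStrictTotalOrder; +-monoʳ-<; supremum
    ; _≤_; Within; Continuous; UpperBound) public

  commutativeRing : CommutativeRing 0ℓ 0ℓ
  commutativeRing = record { isCommutativeRing = isCommutativeRing }

  open CommutativeRing commutativeRing public using
    ( _≈_; _+_; _*_; -_; _-_; 0#; 1#; +-cong; +-congˡ; +-congʳ; +-comm
    ; +-identityˡ; +-identityʳ; *-identityʳ; *-congˡ; distribˡ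
    ; +-abelianGroup; +-commutativeSemigroup)
    renaming (Carrier to R)

  <-strictTotalOrder : StrictTotalOrder 0ℓ 0ℓ 0ℓ
  <-strictTotalOrder = record { isStrictTotalOrder = isStrictTotalOrder }

  open StrictTotalOrder <-strictTotalOrder public
    using (_<_; _<?_; compare; module Eq)
    renaming (trans to <-trans; irrefl to <-irrefl; asym to <-asym
             ; <-respˡ-≈ to <-respˡ; <-respʳ-≈ to <-respʳ)
  open Eq public using () renaming (refl to ≈-refl; sym to ≈-sym; trans to ≈-trans)

  private
    module NonStrict = StrictToNonStrict _≈_ _<_
    module Order = StrictTotalOrderProperties <-strictTotalOrder
    module Maximum = Max Order.totalOrder
    module Group = AbelianGroupProperties +-abelianGroup
    module Semigroup = CommutativeSemigroupProperties +-commutativeSemigroup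
  open Maximum using (_⊔_; ⊔-sel)

  <-≤-trans : ∀ {x y z} → x < y → y ≤ z → x < z
  <-≤-trans = NonStrict.<-≤-trans <-trans <-respʳ

  ≤-<-trans : ∀ {x y z} → x ≤ y → y < z → x < z
  ≤-<-trans = NonStrict.≤-<-trans ≈-sym <-trans <-respˡ

  ≤-<-irrefl : ∀ {x y} → x ≤ y → ¬ y < x
  ≤-<-irrefl x≤y y<x = <-irrefl ≈-refl (≤-<-trans x≤y y<x)

  ≮⇒≥ : ∀ {x y} → ¬ x < y → y ≤ x
  ≮⇒≥ {x} {y} x≮y with compare x y
  ... | tri< x<y _ _ = contradiction x<y x≮y
  ... | tri≈ _ x≈y _ = inj₂ (≈-sym x≈y)
  ... | tri> _ _ y<x = inj₁ y<x

  +-monoˡ-< : ∀ x {y z} → y < z → y + x < z + x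
  +-monoˡ-< x {y} {z} y<z =
    <-respˡ (+-comm x y) (<-respʳ (+-comm x z) (+-monoʳ-< x y<z))

  +-mono-< : ∀ {a b c d} → a < b → c < d → a + c < b + d
  +-mono-< {b = b} {c} a<b c<d = <-trans (+-monoˡ-< c a<b) (+-monoʳ-< b c<d)

  +-cancelʳ-< : ∀ x {y z} → y + x < z + x → y < z
  +-cancelʳ-< x {y} {z} lt = <-respˡ (Group.//-rightDividesʳ x y)
    (<-respʳ (Group.//-rightDividesʳ x z) (+-monoˡ-< (- x) lt))

  +-cancelˡ-< : ∀ x {y z} → x + y < x + z → y < z
  +-cancelˡ-< x {y} {z} lt =
    +-cancelʳ-< x (<-respˡ (+-comm x y) (<-respʳ (+-comm x z) lt))

  -‿cancel : ∀ x y → x - y + y ≈ x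
  -‿cancel x y = Group.//-rightDividesˡ y x

  <+⇒-< : ∀ {x y z} → x < z + y → x - y < z
  <+⇒-< {x} {y} {z} lt = +-cancelʳ-< y (<-respˡ (≈-sym (-‿cancel x y)) lt)

  -<⇒<+ : ∀ {x y z} → x - y < z → x < z + y
  -<⇒<+ {x} {y} lt = <-respˡ (-‿cancel x y) (+-monoˡ-< y lt)

  +<⇒<- : ∀ {x y z} → x + y < z → x < z - y
  +<⇒<- {x} {y} {z} lt = +-cancelʳ-< y (<-respʳ (≈-sym (-‿cancel z y)) lt)

  x<y⇒0<y-x : ∀ {x y} → x < y → 0# < y - x
  x<y⇒0<y-x {x} x<y = +<⇒<- (<-respˡ (≈-sym (+-identityˡ x)) x<y)

  x<y⇒x-y<0 : ∀ {x y} → x < y → x - y < 0#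
  x<y⇒x-y<0 {y = y} x<y = <+⇒-< (<-respʳ (≈-sym (+-identityˡ y)) x<y)

  x<x+y : ∀ x {y} → 0# < y → x < x + y
  x<x+y x 0<y = <-respˡ (+-identityʳ x) (+-monoʳ-< x 0<y)

  x-y<x : ∀ x {y} → 0# < y → x - y < x
  x-y<x x 0<y = <+⇒-< (x<x+y x 0<y)

  -‿antitone : ∀ x {y z} → x - y < x - z → z < y
  -‿antitone x {y} {z} lt = +-cancelˡ-< (x - z)
    (<-respˡ (≈-sym (-‿cancel x z)) (-<⇒<+ lt))

  positive : ∃ λ u → 0# < u
  positive with compare 0# 1#
  ... | tri< 0<1 _ _ = 1# , 0<1
  ... | tri≈ _ 0≈1 _ = contradiction 0≈1 0≉1
  -- Were 1 negative, its opposite would serve as the positive element.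
  ... | tri> _ _ 1<0 = 0# - 1# , x<y⇒0<y-x 1<0

  1+1≉0 : ¬ (1# + 1# ≈ 0#)
  1+1≉0 2≈0 with compare 0# 1#
  ... | tri< 0<1 _ _ = <-irrefl (≈-trans (+-identityˡ 0#) (≈-sym 2≈0)) (+-mono-< 0<1 0<1)
  ... | tri≈ _ 0≈1 _ = 0≉1 0≈1
  ... | tri> _ _ 1<0 = <-irrefl (≈-trans 2≈0 (≈-sym (+-identityˡ 0#))) (+-mono-< 1<0 1<0)

  half : ∀ x → ∃ λ y → y + y ≈ x
  half x with inverse (1# + 1#) 1+1≉0
  ... | y , 2y≈1 = x * y ,
    ≈-trans (≈-sym (distribˡ x y y)) (
    ≈-trans (*-congˡ (≈-trans (≈-sym y+y≈2y) 2y≈1)) (*-identityʳ x))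
    where
    open CommutativeRing commutativeRing using (distribʳ; *-identityˡ)
    y+y≈2y : (1# + 1#) * y ≈ y + y
    y+y≈2y = ≈-trans (distribʳ y 1# 1#) (+-cong (*-identityˡ y) (*-identityˡ y))

  half-positive : ∀ {x} → 0# < x → ∃ λ y → 0# < y × y + y ≈ x
  half-positive {x} 0<x with half x
  ... | y , y+y≈x with compare 0# y
  ...   | tri< 0<y _ _ = y , 0<y , y+y≈x
  ...   | tri≈ _ 0≈y _ = contradiction 0<x
    (<-irrefl (≈-trans (≈-sym (+-identityˡ 0#)) (≈-trans (+-cong 0≈y 0≈y) y+y≈x)))
  ...   | tri> _ _ y<0 = contradiction 0<x
    (<-asym (<-respˡ y+y≈x (<-respʳ (+-identityˡ 0#) (+-mono-< y<0 y<0))))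

  dense : ∀ {x y} → x < y → ∃ λ z → x < z × z < y
  dense {x} {y} x<y with half-positive (x<y⇒0<y-x x<y)
  ... | h , 0<h , 2h≈y-x = h + x , <-respʳ (+-comm x h) (x<x+y x 0<h) ,
    <-respʳ (-‿cancel y x) (+-monoˡ-< x (<-respʳ 2h≈y-x (x<x+y h 0<h)))

  -- Serves to choose one radius smaller than two given ones, or a point just after `a` ahead of two
  -- bounds.
  below-both : ∀ {a x y} → a < x → a < y → ∃ λ z → a < z × z < x × z < y
  below-both {a} {x} {y} a<x a<y with x <? y
  ... | yes x<y = let z , a<z , z<x = dense a<x in z , a<z , z<x , <-trans z<x x<y
  ... | no x≮y  = let z , a<z , z<y = dense a<y in z , a<z , <-≤-trans z<y (≮⇒≥ x≮y) , z<y

  Within-refl : ∀ {δ x y} → 0# < δ → x ≈ y → Within δ x y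
  Within-refl {δ} {x} {y} 0<δ x≈y =
    <+⇒-< (<-respˡ (≈-trans (+-identityˡ y) (≈-sym x≈y)) (+-monoˡ-< y 0<δ)) ,
    <+⇒-< (<-respˡ (≈-trans (+-identityˡ x) x≈y) (+-monoˡ-< x 0<δ))

  Within-< : ∀ {δ x y z} → Within δ x y → δ < z → Within z x y
  Within-< (p , q) δ<z = <-trans p δ<z , <-trans q δ<z

  -- Continuous functions

  -- Splits the increment of a difference into the increments of its two terms.
  -‿interchange : ∀ a b c d → (a - b) - (c - d) ≈ (a - c) + (d - b)
  -‿interchange a b c d =
    ≈-trans (+-congˡ (≈-trans (Group.⁻¹-anti-homo‿- c d) (+-comm d (- c)))) (
    ≈-trans (Semigroup.interchange a (- b) (- c) d) (+-congˡ (+-comm (- b) d)))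

  Continuous₂ : ∀ {f g} → Continuous f → Continuous g → ∀ t ε → 0# < ε →
    ∃ λ δ → 0# < δ × (∀ s → Within δ s t → Within ε (f s) (f t) × Within ε (g s) (g t))
  Continuous₂ cf cg t ε 0<ε with cf t ε 0<ε | cg t ε 0<ε
  ... | δ₁ , 0<δ₁ , near₁ | δ₂ , 0<δ₂ , near₂ with below-both 0<δ₁ 0<δ₂
  ...   | δ , 0<δ , δ<δ₁ , δ<δ₂ = δ , 0<δ , λ s near →
    near₁ s (Within-< near δ<δ₁) , near₂ s (Within-< near δ<δ₂)

  const-continuous : ∀ c → Continuous (λ _ → c)
  const-continuous c t ε 0<ε = ε , 0<ε , λ _ _ → Within-refl 0<ε ≈-refl

  sub-continuous : ∀ {f g} → Continuous f → Continuous g → Continuous (λ t → f t - g t)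
  sub-continuous {f} {g} cf cg t ε 0<ε with half-positive 0<ε
  ... | h , 0<h , 2h≈ε with Continuous₂ cf cg t h 0<h
  ...   | δ , 0<δ , near = δ , 0<δ , λ s s~t →
    let (fs-ft<h , ft-fs<h) , (gs-gt<h , gt-gs<h) = near s s~t in
    bound fs-ft<h gt-gs<h , bound ft-fs<h gs-gt<h
    where
    bound : ∀ {a b c d} → a - c < h → d - b < h → (a - b) - (c - d) < ε
    bound p q = <-respˡ (≈-sym (-‿interchange _ _ _ _)) (<-respʳ 2h≈ε (+-mono-< p q))

  -- A maximum increases by no more than the function attaining it at the new point does. This
  -- one-sided bound is applied in both directions.
  ⊔-continuous : ∀ {f g} → Continuous f → Continuous g → Continuous (λ t → f t ⊔ g t)
  ⊔-continuous {f} {g} cf cg t ε 0<ε with Continuous₂ cf cg t ε 0<ε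
  ... | δ , 0<δ , near = δ , 0<δ , λ s s~t →
    let (fs-ft<ε , ft-fs<ε) , (gs-gt<ε , gt-gs<ε) = near s s~t in
    bound fs-ft<ε gs-gt<ε , bound ft-fs<ε gt-gs<ε
    where
    +-monoʳ-≤ : ∀ x {y z} → y ≤ z → x + y ≤ x + z
    +-monoʳ-≤ x (inj₁ y<z) = inj₁ (+-monoʳ-< x y<z)
    +-monoʳ-≤ x (inj₂ y≈z) = inj₂ (+-congˡ y≈z)

    bound : ∀ {a b c d} → a - c < ε → b - d < ε → (a ⊔ b) - (c ⊔ d) < ε
    bound {a} {b} {c} {d} p q with ⊔-sel a b
    ... | inj₁ a⊔b≈a = <+⇒-< (<-respˡ (≈-sym a⊔b≈a)
      (<-≤-trans (-<⇒<+ p) (+-monoʳ-≤ ε (Maximum.x≤x⊔y c d))))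
    ... | inj₂ a⊔b≈b = <+⇒-< (<-respˡ (≈-sym a⊔b≈b)
      (<-≤-trans (-<⇒<+ q) (+-monoʳ-≤ ε (Maximum.x≤y⊔x c d))))

  continuousUpperBound : ∀ {n} (f : Fin n → R → R) → (∀ i → Continuous (f i)) →
    ∃ λ u → Continuous u × (∀ i t → f i t < u t)
  continuousUpperBound {zero}  f cf = (λ _ → 0#) , const-continuous 0# , λ ()
  continuousUpperBound {suc n} f cf
    with continuousUpperBound (f ∘ suc) (cf ∘ suc) | positive
  ... | u , cu , f<u | δ , 0<δ =
    -- Subtracting `0# - δ` adds `δ`, which makes the bound on `f zero` strict and lets
    -- `sub-continuous` apply.
    (λ t → (f zero t - (0# - δ)) ⊔ u t) ,
    ⊔-continuous (sub-continuous (cf zero) (const-continuous _)) cu ,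
    λ where
      zero t    → <-≤-trans (f<f+δ (f zero t)) (Maximum.x≤x⊔y _ _)
      (suc i) t → <-≤-trans (f<u i t) (Maximum.x≤y⊔x _ _)
    where
    f<f+δ : ∀ x → x < x - (0# - δ)
    f<f+δ x = +<⇒<- (<-respʳ (+-identityʳ x) (+-monoʳ-< x (x<y⇒x-y<0 0<δ)))

  continuousLowerBound : ∀ {n} (f : Fin n → R → R) → (∀ i → Continuous (f i)) →
    ∃ λ l → Continuous l × (∀ i t → l t < f i t)
  continuousLowerBound f cf with continuousUpperBound (λ i t → 0# - f i t)
                                   (λ i → sub-continuous (const-continuous 0#) (cf i))
  ... | u , cu , -f<u = (λ t → 0# - u t) , sub-continuous (const-continuous 0#) cu ,
    λ i t → <+⇒-< (<-respʳ (+-comm (u t) (f i t)) (-<⇒<+ (-f<u i t)))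

  -- Fix `c` strictly between the two values at `t`. Close to `t`, continuity keeps `f` below `c`
  -- and `g` above it.
  <-open : ∀ {f g} → Continuous f → Continuous g → ∀ t → f t < g t →
    ∃ λ δ → 0# < δ × (∀ s → Within δ s t → f s < g s)
  <-open {f} {g} cf cg t ft<gt with dense ft<gt
  ... | c , ft<c , c<gt with below-both (x<y⇒0<y-x ft<c) (x<y⇒0<y-x c<gt)
  ...   | ε , 0<ε , ε<c-ft , ε<gt-c with Continuous₂ cf cg t ε 0<ε
  ...     | δ , 0<δ , near = δ , 0<δ , λ s s~t →
    let (fs-ft<ε , _) , (_ , gt-gs<ε) = near s s~t in
    <-trans (+-cancelʳ-< (- f t) (<-trans fs-ft<ε ε<c-ft))
            (-‿antitone (g t) (<-trans gt-gs<ε ε<gt-c))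

  -- Intermediate value theorem

  module _ {f g} (cf : Continuous f) (cg : Continuous g) {a b} (a≤b : a ≤ b)
    (apart : ∀ x → a ≤ x → x ≤ b → ¬ f x ≈ g x) where

    private
      P : Pred R 0ℓ
      P x = a ≤ x × x ≤ b × f x < g x

      module _ s (s-upper : UpperBound P s) (s-least : ∀ c → UpperBound P c → s ≤ c)
        (a≤s : a ≤ s) (s≤b : s ≤ b) where

        -- If `f` is below `g` at `s`, then by openness so it is slightly later, which contradicts
        -- `s` being an upper bound unless `s` is `b`. If `g` is below `f` at `s`, then `P` fails on
        -- a whole neighbourhood, so a smaller upper bound exists.
        atSupremum : Tri (f s < g s) (f s ≈ g s) (g s < f s) → f b < g b
        atSupremum (tri≈ _ fs≈gs _) = contradiction fs≈gs (apart s a≤s s≤b)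
        atSupremum (tri< fs<gs _ _) = beyond s≤b (<-open cf cg s fs<gs)
          where
          beyond : s ≤ b → (∃ λ δ → 0# < δ × (∀ x → Within δ x s → f x < g x)) → f b < g b
          -- Functions need not respect `_≈_` by definition, so the inequality reaches `b` through
          -- the neighbourhood of `s`.
          beyond (inj₂ s≈b) (δ , 0<δ , near) = near b (Within-refl 0<δ (≈-sym s≈b))
          beyond (inj₁ s<b) (δ , 0<δ , near) =
            let x , s<x , x<b , x<s+δ = below-both s<b (x<x+y s 0<δ)
                x~s : Within δ x s
                x~s = <+⇒-< (<-respʳ (+-comm s δ) x<s+δ) , <-trans (x<y⇒x-y<0 s<x) 0<δ
            in contradiction s<x (≤-<-irrefl
                 (s-upper x (inj₁ (≤-<-trans a≤s s<x) , inj₁ x<b , near x x~s)))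
        atSupremum (tri> _ _ gs<fs) = recede (<-open cg cf s gs<fs)
          where
          recede : (∃ λ δ → 0# < δ × (∀ x → Within δ x s → g x < f x)) → f b < g b
          recede (δ , 0<δ , near) =
            contradiction (x-y<x s 0<δ) (≤-<-irrefl (s-least (s - δ) upper))
            where
            x-s<δ : ∀ {x} → x ≤ s → x - s < δ
            x-s<δ x≤s = <+⇒-< (≤-<-trans x≤s (<-respʳ (+-comm s δ) (x<x+y s 0<δ)))

            s-x<δ : ∀ {x} → s - δ < x → s - x < δ
            s-x<δ {x} s-δ<x = <+⇒-< (<-respʳ (+-comm x δ) (-<⇒<+ s-δ<x))

            upper : UpperBound P (s - δ)
            upper x (a≤x , x≤b , fx<gx) = ≮⇒≥ λ s-δ<x → <-asym fx<gx
              (near x (x-s<δ (s-upper x (a≤x , x≤b , fx<gx)) , s-x<δ s-δ<x))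

    <-persists : f a < g a → f b < g b
    <-persists fa<ga =
      let a∈P = inj₂ ≈-refl , a≤b , fa<ga
          b-upper = λ { _ (_ , x≤b , _) → x≤b }
          s , s-upper , s-least = supremum P (a , a∈P) (b , b-upper)
      in atSupremum s s-upper s-least (s-upper a a∈P) (s-least b b-upper) (compare (f s) (g s))

  -- Sampling between the members of an increasing sequence

  -- The lower bound `a` lets the recursion restart with the first time in its role, once that time
  -- has been passed.
  separate : ∀ {m} (time : Fin m → R) → (∀ {k l} → k Fin.< l → time k < time l) →
    ∀ a → (∀ l → a < time l) → (k : Fin (suc m)) →
    ∃ λ t → a < t × (∀ l → (toℕ l ℕ.< toℕ k → time l < t) × (toℕ k ℕ.≤ toℕ l → t < time l))
  separate {zero} time inc a a<time zero =
    let u , 0<u = positive in a + u , x<x+y a 0<u , λ ()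
  separate {suc m} time inc a a<time zero with dense (a<time zero)
  ... | t , a<t , t<time₀ = t , a<t , λ where
    zero    → (λ ()) , λ _ → t<time₀
    (suc l) → (λ ()) , λ _ → <-trans t<time₀ (inc (s≤s z≤n))
  separate {suc m} time inc a a<time (suc k)
    with separate (time ∘ suc) (λ k<l → inc (s≤s k<l)) (time zero) (λ l → inc (s≤s z≤n)) k
  ... | t , time₀<t , between = t , <-trans (a<time zero) time₀<t , λ where
    zero    → (λ _ → time₀<t) , λ ()
    (suc l) → (λ { (s≤s l<k) → proj₁ (between l) l<k }) ,
              (λ { (s≤s k≤l) → proj₂ (between l) k≤l })

  lowerBound : ∀ {m} (f : Fin m → R) → ∃ λ a → ∀ l → a < f l
  lowerBound f =
    let l , _ , l<f = continuousLowerBound (λ i _ → f i) (λ i → const-continuous (f i))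
    in l 0# , λ i → l<f i 0#

-- Orders on places and on objects

witness : ∀ {a} {A : Set a} (a? : Dec A) → does a? ≡ true → A
witness (yes a) _ = a

xor-false⇒≡ : ∀ x y → x xor y ≡ false → x ≡ y
xor-false⇒≡ false false _ = refl
xor-false⇒≡ true  true  _ = refl

xor-true⇒≢ : ∀ x y → x xor y ≡ true → x ≡ not y
xor-true⇒≢ false true  _ = refl
xor-true⇒≢ true  false _ = refl

module _ {n ℓ₁ ℓ₂} {_≺₁_ : Rel (Fin n) ℓ₁} {_≺₂_ : Rel (Fin n) ℓ₂} (asym : Asymmetric _≺₁_)
  (π ρ : Permutation′ n) (π-sorts : Sorts _≺₁_ π) (ρ-sorts : Sorts _≺₂_ ρ) where

  private
    place-< : ∀ {x y} → x ≺₁ y → (π ⟨$⟩ˡ x) Fin.< (π ⟨$⟩ˡ y)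
    place-< x≺y = sorts-reflects {_≺_ = _≺₁_} asym π π-sorts
      (subst₂ _≺₁_ (sym (Perm.inverseʳ π)) (sym (Perm.inverseʳ π)) x≺y)

  -- The places of `x` and `y` under `π` are increasing, and the same places hold `x` and `y` under
  -- `ρ`.
  sorts-≈ : π Perm.≈ ρ → ∀ {x y} → x ≺₁ y → x ≺₂ y
  sorts-≈ π≈ρ x≺y = subst₂ _≺₂_ (occupant _) (occupant _) (ρ-sorts (place-< x≺y))
    where
    occupant : ∀ x → ρ ⟨$⟩ʳ (π ⟨$⟩ˡ x) ≡ x
    occupant x = trans (sym (π≈ρ _)) (Perm.inverseʳ π)

  -- Under `ρ` the two objects occupy the opposite places, whose order is reversed.
  sorts-reverse : π Perm.≈ reverse ∘ₚ ρ → ∀ {x y} → x ≺₁ y → y ≺₂ x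
  sorts-reverse π≈ρ x≺y =
    subst₂ _≺₂_ (occupant _) (occupant _) (ρ-sorts (opposite-anti-< (place-< x≺y)))
    where
    occupant : ∀ x → ρ ⟨$⟩ʳ opposite (π ⟨$⟩ˡ x) ≡ x
    occupant x = trans (sym (π≈ρ _)) (Perm.inverseʳ π)

-- Trajectories

module Kinematics (ℝ : CompleteOrderedField) where
  open Field ℝ
  open Motion ℝ

  module Family {n m} {h : History n m} {v : Fin n → R → R}
    (trajectories : IsTrajectoryFamily v) (history : HasHistory v h) where
    open IsTrajectoryFamily trajectories
    open HasHistory history

    Ahead : R → Rel (Fin n) 0ℓ
    Ahead t i j = v i t < v j t

    Ahead-asym : ∀ {t} → Asymmetric (Ahead t)
    Ahead-asym = <-asym

    Ahead⇒≢ : ∀ {t i j} → Ahead t i j → i ≢ j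
    Ahead⇒≢ i<j refl = <-irrefl ≈-refl i<j

    ¬Ahead⇒Ahead : ∀ {i j t} → i ≢ j → ¬ Collide v i j t → ¬ Ahead t i j → Ahead t j i
    ¬Ahead⇒Ahead {i} {j} {t} i≢j apart i≮j with compare (v i t) (v j t)
    ... | tri< i<j _ _ = contradiction i<j i≮j
    ... | tri≈ _ i≈j _ = contradiction (i≢j , i≈j) apart
    ... | tri> _ _ j<i = j<i

    Collide-sym : ∀ {i j t} → Collide v i j t → Collide v j i t
    Collide-sym (i≢j , i≈j) = ≢-sym i≢j , ≈-sym i≈j

    module _ {i j a b} (i≢j : i ≢ j) (a≤b : a ≤ b)
      (apart : ∀ x → a ≤ x → x ≤ b → ¬ Collide v i j x) where

      Ahead-persists : Ahead a i j → Ahead b i j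
      Ahead-persists = <-persists (continuous i) (continuous j) a≤b
        λ x a≤x x≤b i≈j → apart x a≤x x≤b (i≢j , i≈j)

    -- For the converse, one of the two orders holds at `a`, and the wrong one would persist to `b`.
    Ahead-⇔ : ∀ {i j a b} → i ≢ j → a ≤ b → (∀ x → a ≤ x → x ≤ b → ¬ Collide v i j x) →
      Ahead a i j ⇔ Ahead b i j
    Ahead-⇔ {i} {j} {a} i≢j a≤b apart = mk⇔ (Ahead-persists i≢j a≤b apart) λ i<j →
      ¬Ahead⇒Ahead (≢-sym i≢j) (λ c → apart a (inj₂ ≈-refl) a≤b (Collide-sym c)) λ j<i →
      Ahead-asym i<j (Ahead-persists (≢-sym i≢j) a≤b
        (λ x a≤x x≤b c → apart x a≤x x≤b (Collide-sym c)) j<i)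

    Between-apart : ∀ {k t i j} → Between k t → ¬ Collide v i j t
    Between-apart {k} {t} {i} {j} t∈k c with Equivalence.to (collisions i j t) c
    ... | l , t≈l , _ with toℕ l ℕP.<? toℕ k
    ...   | yes l<k = <-irrefl (≈-sym t≈l) (proj₁ (t∈k l) l<k)
    ...   | no l≮k  = <-irrefl t≈l (proj₂ (t∈k l) (ℕP.≮⇒≥ l≮k))

    Between-convex : ∀ {k a b x} → Between k a → Between k b → a ≤ x → x ≤ b → Between k x
    Between-convex a∈k b∈k a≤x x≤b l =
      (λ l<k → <-≤-trans (proj₁ (a∈k l) l<k) a≤x) ,
      (λ k≤l → ≤-<-trans x≤b (proj₂ (b∈k l) k≤l))

    Between-Ahead : ∀ {k a b i j} → Between k a → Between k b → i ≢ j → Ahead a i j → Ahead b i j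
    Between-Ahead {k} {a} {b} a∈k b∈k i≢j with a <? b
    ... | yes a<b = Equivalence.to (Ahead-⇔ i≢j (inj₁ a<b)
      λ x a≤x x≤b → Between-apart (Between-convex a∈k b∈k a≤x x≤b))
    ... | no a≮b  = Equivalence.from (Ahead-⇔ i≢j (≮⇒≥ a≮b)
      λ x b≤x x≤a → Between-apart (Between-convex b∈k a∈k b≤x x≤a))

    -- Only the interval containing a sample time matters, so its construction is kept opaque.
    abstract
      sample : ∀ k → ∃ (Between k)
      sample k =
        let a , a<time = lowerBound time
            t , _ , between = separate time increasing a a<time k
        in t , between

    τ : Fin (suc m) → R
    τ k = proj₁ (sample k)

    τ∈ : ∀ k → Between k (τ k)
    τ∈ k = proj₂ (sample k)

    -- The times `s` and `t` enclose collision `k` and no other: `inject₁ k` counts the collisions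
    -- before it, `suc k` includes it.
    module Step k {s t} (s∈ : Between (inject₁ k) s) (t∈ : Between (suc k) t) where

      s<time : s < time k
      s<time = proj₂ (s∈ k) (ℕP.≤-reflexive (FinP.toℕ-inject₁ k))

      time<t : time k < t
      time<t = proj₁ (t∈ k) ℕP.≤-refl

      onlyCollision : ∀ {i j x} → s ≤ x → x ≤ t → Collide v i j x → x ≈ time k × Joins (h k) i j
      onlyCollision {i} {j} {x} s≤x x≤t c with Equivalence.to (collisions i j x) c
      ... | l , x≈l , e with FinP.<-cmp l k
      ...   | tri≈ _ refl _ = x≈l , e
      ...   | tri< l<k _ _  = contradiction
        (<-≤-trans (proj₁ (s∈ l) (subst (toℕ l ℕ.<_) (sym (FinP.toℕ-inject₁ k)) l<k)) s≤x)
        (<-irrefl (≈-sym x≈l))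
      ...   | tri> _ _ k<l  =
        contradiction (≤-<-trans x≤t (proj₂ (t∈ l) k<l)) (<-irrefl x≈l)

      Ahead-other : ∀ {i j} → i ≢ j → ¬ Joins (h k) i j → Ahead s i j ⇔ Ahead t i j
      Ahead-other i≢j ¬e = Ahead-⇔ i≢j (inj₁ (<-trans s<time time<t))
        λ x s≤x x≤t c → ¬e (proj₂ (onlyCollision s≤x x≤t c))

      module _ {i j} (e : Joins (h k) i j) where
        private
          i≢j = Joins-≢ (h k) e

          collide : Collide v i j (time k)
          collide = Equivalence.from (collisions i j (time k)) (k , ≈-refl , e)

        lessBefore : Ahead s i j → LessBefore v i j (time k)
        -- This radius makes the window before the collision begin exactly at `s`.
        lessBefore i<j = time k - s , x<y⇒0<y-x s<time , λ x lt x<time →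
          let s<x = +-cancelʳ-< (time k - s) (<-respˡ
                (≈-trans (≈-sym (-‿cancel (time k) s)) (+-comm (time k - s) s)) (-<⇒<+ lt))
          in Ahead-persists i≢j (inj₁ s<x) (λ y s≤y y≤x c →
               let y<time = ≤-<-trans y≤x x<time
               in <-irrefl (proj₁ (onlyCollision s≤y (inj₁ (<-trans y<time time<t)) c)) y<time)
             i<j

        -- The order persists from `s` up to the collision and is reversed just after it; the
        -- reversed order then persists to `t`.
        Ahead-crosses : Ahead s i j → Ahead t j i
        Ahead-crosses i<j = fromAfter (crossing i j (time k) collide (lessBefore i<j))
          where
          fromAfter : LessAfter v j i (time k) → Ahead t j i
          fromAfter (ε , 0<ε , after) =
            let y , time<y , y<time+ε , y<t = below-both (x<x+y (time k) 0<ε) time<t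
            in Ahead-persists (≢-sym i≢j) (inj₁ y<t) (λ z y≤z z≤t c →
                 let time<z = <-≤-trans time<y y≤z
                 in <-irrefl (≈-sym (proj₁ (onlyCollision
                      (inj₁ (<-trans s<time time<z)) z≤t c))) time<z)
               (after y time<y y<time+ε)

      module _ {i c} (i≢c : i ≢ c) (¬e : ¬ Joins (h k) i c) where

        -- Carries the order of a pair that does not collide to the very instant of collision `k`,
        -- where the colliding objects share one position.
        Ahead-time : Ahead s i c ⇔ Ahead (time k) i c
        Ahead-time = Ahead-⇔ i≢c (inj₁ s<time) λ x s≤x x≤time col →
          ¬e (proj₂ (onlyCollision s≤x (inj₁ (≤-<-trans x≤time time<t)) col))

      -- Two objects about to collide are neighbours, hence on the same side of any third.
      Ahead-neighbours : ∀ {a b c} → Joins (h k) a b → c ≢ a → c ≢ b → Ahead s a c → Ahead s b c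
      Ahead-neighbours {a} {b} {c} e c≢a c≢b a<c =
        Equivalence.from
          (Ahead-time (≢-sym c≢b) λ bc → c≢a (Joins-unique (h k) bc (Joins-sym (h k) e)))
          (<-respˡ a≈b (Equivalence.to
            (Ahead-time (≢-sym c≢a) λ ac → c≢b (Joins-unique (h k) ac e)) a<c))
        where
        a≈b : v a (time k) ≈ v b (time k)
        a≈b = proj₂ (Equivalence.from (collisions a b (time k)) (k , ≈-refl , e))

    Ahead? : ∀ k i j → Dec (Ahead (τ k) i j)
    Ahead? k i j = v i (τ k) <? v j (τ k)

    -- Orders are recorded as Booleans, at one sample time per interval, so that two families can be
    -- compared by `_xor_`.
    ahead : Fin (suc m) → Fin n → Fin n → Bool
    ahead k i j = does (Ahead? k i j)

    ahead-sym : ∀ k {i j} → i ≢ j → ahead k i j ≡ not (ahead k j i)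
    ahead-sym k {i} {j} i≢j = does-⇔
      (mk⇔ Ahead-asym (¬Ahead⇒Ahead (≢-sym i≢j) (Between-apart (τ∈ k))))
      (Ahead? k i j) (¬? (Ahead? k j i))

    ahead-other : ∀ k {i j} → i ≢ j → ¬ Joins (h k) i j →
      ahead (suc k) i j ≡ ahead (inject₁ k) i j
    ahead-other k {i} {j} i≢j ¬e = sym (does-⇔
      (Step.Ahead-other k (τ∈ (inject₁ k)) (τ∈ (suc k)) i≢j ¬e)
      (Ahead? (inject₁ k) i j) (Ahead? (suc k) i j))

    ahead-crosses : ∀ k {i j} → Joins (h k) i j → ahead (suc k) i j ≡ not (ahead (inject₁ k) i j)
    ahead-crosses k {i} {j} e = does-⇔
      (mk⇔ (λ i<j′ i<j → Ahead-asym i<j′ (S.Ahead-crosses e i<j))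
           (λ i≮j → S.Ahead-crosses (Joins-sym (h k) e)
             (¬Ahead⇒Ahead (Joins-≢ (h k) e) (Between-apart (τ∈ (inject₁ k))) i≮j)))
      (Ahead? (suc k) i j) (¬? (Ahead? (inject₁ k) i j))
      where module S = Step k (τ∈ (inject₁ k)) (τ∈ (suc k))

    ahead-neighbours : ∀ k {a b c} → Joins (h k) a b → c ≢ a → c ≢ b →
      ahead (inject₁ k) a c ≡ ahead (inject₁ k) b c
    ahead-neighbours k {a} {b} {c} e c≢a c≢b = does-⇔
      (mk⇔ (S.Ahead-neighbours e c≢a c≢b) (S.Ahead-neighbours (Joins-sym (h k) e) c≢b c≢a))
      (Ahead? (inject₁ k) a c) (Ahead? (inject₁ k) b c)
      where module S = Step k (τ∈ (inject₁ k)) (τ∈ (suc k))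

    -- The objects are sorted at each sample time; no order changes within an interval free of
    -- collisions.
    positions : ∃ HasPositions
    positions = (λ k → proj₁ (sorted k)) , λ k t t∈k a<b →
      let pa<pb = proj₂ (sorted k) a<b in Between-Ahead (τ∈ k) t∈k (Ahead⇒≢ pa<pb) pa<pb
      where
      sorted : ∀ k → ∃ (Sorts (Ahead (τ k)))
      sorted k = sort <-strictTotalOrder (λ i → v i (τ k))
        λ i j i≢j i≈j → Between-apart (τ∈ k) (i≢j , i≈j)

  -- Connected histories determine the positions

  module Comparison {n m} {h : History n m} (conn : Connected h) {v w : Fin n → R → R}
    (tv : IsTrajectoryFamily v) (tw : IsTrajectoryFamily w)
    (hv : HasHistory v h) (hw : HasHistory w h) where

    module V = Family tv hv
    module W = Family tw hw

    -- Whether v and w order i and j differently. A collision flips both orders,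
    -- so this does not depend on k.
    χ : Fin (suc m) → Fin n → Fin n → Bool
    χ k i j = V.ahead k i j xor W.ahead k i j

    χ-step : ∀ k {i j} → i ≢ j → χ (suc k) i j ≡ χ (inject₁ k) i j
    χ-step k {i} {j} i≢j with Joins? (h k) i j
    ... | yes e = trans (cong₂ _xor_ (V.ahead-crosses k e) (W.ahead-crosses k e))
      (xor-annihilates-not (V.ahead (inject₁ k) i j) (W.ahead (inject₁ k) i j))
    ... | no ¬e = cong₂ _xor_ (V.ahead-other k i≢j ¬e) (W.ahead-other k i≢j ¬e)

    χ₀ = χ zero

    χ-invariant : ∀ {i j} → i ≢ j → ∀ k → χ k i j ≡ χ₀ i j
    χ-invariant i≢j = <-weakInduction _ refl λ k → trans (χ-step k i≢j)

    χ₀-sym : ∀ i j → i ≢ j → χ₀ i j ≡ χ₀ j i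
    χ₀-sym i j i≢j = trans (cong₂ _xor_ (V.ahead-sym zero i≢j) (W.ahead-sym zero i≢j))
      (xor-annihilates-not (V.ahead zero j i) (W.ahead zero j i))

    -- Invariance moves the comparison to the interval just before collision `k`, where in both
    -- families `c` lies on the same side of `a` and `b`.
    χ₀-slide : ∀ a b c → Adjacent h a b → c ≢ a → c ≢ b → χ₀ a c ≡ χ₀ b c
    χ₀-slide a b c (k , e) c≢a c≢b =
      trans (sym (χ-invariant (≢-sym c≢a) (inject₁ k))) (
      trans (cong₂ _xor_ (V.ahead-neighbours k e c≢a c≢b) (W.ahead-neighbours k e c≢a c≢b))
            (χ-invariant (≢-sym c≢b) (inject₁ k)))

    -- If no pair is reversed, `q k` sorts the order that `v` has in interval `k`; if all are, its
    -- reverse does. As `p k` sorts that order too, uniqueness of sorting applies.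
    equalUpToInversion : ∀ p q → HasHistory.HasPositions hv p → HasHistory.HasPositions hw q →
      EqualUpToInversion p q
    equalUpToInversion p q p-sorts q-sorts =
      conclude (constantOffDiagonal χ₀ (Slide.constant χ₀ χ₀-sym χ₀-slide conn))
      where
      conclude : (∃ λ b → ∀ i j → i ≢ j → χ₀ i j ≡ b) → EqualUpToInversion p q
      conclude (false , agree)   = inj₁ λ k →
        sorts-unique {_≺_ = V.Ahead (V.τ k)} V.Ahead-asym (p k) (q k) (p-sorts k _ (V.τ∈ k))
        λ a<b →
          let qa<qb = q-sorts k _ (W.τ∈ k) a<b
              qa≢qb = W.Ahead⇒≢ qa<qb
          in witness (V.Ahead? k _ _) (trans
               (xor-false⇒≡ _ _ (trans (χ-invariant qa≢qb k) (agree _ _ qa≢qb)))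
               (dec-true (W.Ahead? k _ _) qa<qb))
      conclude (true , disagree) = inj₂ λ k →
        sorts-unique {_≺_ = V.Ahead (V.τ k)} V.Ahead-asym (p k) (reverse ∘ₚ q k)
        (p-sorts k _ (V.τ∈ k)) λ a<b →
          let qb<qa = q-sorts k _ (W.τ∈ k) (opposite-anti-< a<b)
              qa≢qb = ≢-sym (W.Ahead⇒≢ qb<qa)
          in witness (V.Ahead? k _ _) (trans
               (xor-true⇒≢ _ _ (trans (χ-invariant qa≢qb k) (disagree _ _ qa≢qb)))
               (cong not (dec-false (W.Ahead? k _ _) (W.Ahead-asym qb<qa))))

  connected⇒unique : ∀ {n m} {h : History n m} → Connected h → UniquePositions h
  connected⇒unique conn v w tv tw hv hw = Comparison.equalUpToInversion conn tv tw hv hw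

  -- Rearranging the classes of a disconnected history

  module Shift {n m} {h : History n m} {v : Fin n → R → R}
    (trajectories : IsTrajectoryFamily v) (history : HasHistory v h)
    (lo hi : R → R) (lo-continuous : Continuous lo) (hi-continuous : Continuous hi)
    (lo<v : ∀ i t → lo t < v i t) (v<hi : ∀ i t → v i t < hi t)
    (upper : Fin n → Bool) (upper-closed : ∀ k {i j} → Joins (h k) i j → upper i ≡ upper j) where
    open IsTrajectoryFamily trajectories
    open HasHistory history

    -- Subtracting the lower bound makes a trajectory positive, subtracting the upper bound makes it
    -- negative; zero then separates the classes.
    offset : Bool → R → R
    offset true  = lo
    offset false = hi

    shifted : Fin n → R → R
    shifted i t = v i t - offset (upper i) t

    shifted-< : ∀ {i j} t → upper i ≡ upper j → v i t < v j t → shifted i t < shifted j t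
    shifted-< {i} {j} t eq i<j = subst (λ b → v i t - offset (upper i) t < v j t - offset b t)
      eq (+-monoˡ-< _ i<j)

    shifted-<⁻ : ∀ {i j} t → upper i ≡ upper j → shifted i t < shifted j t → v i t < v j t
    shifted-<⁻ {i} {j} t eq i<j = +-cancelʳ-< _
      (subst (λ b → shifted i t < v j t - offset b t) (sym eq) i<j)

    shifted-separates : ∀ {i j} t → upper i ≡ true → upper j ≡ false → shifted j t < shifted i t
    shifted-separates {i} {j} t i-upper j-lower = <-trans
      (subst (λ b → v j t - offset b t < 0#) (sym j-lower) (x<y⇒x-y<0 (v<hi j t)))
      (subst (λ b → 0# < v i t - offset b t) (sym i-upper) (x<y⇒0<y-x (lo<v i t)))

    shifted-≈⇒upper-≡ : ∀ {i j t} → shifted i t ≈ shifted j t → upper i ≡ upper j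
    shifted-≈⇒upper-≡ {i} {j} {t} i≈j = cases (upper i) (upper j) refl refl
      where
      cases : ∀ b c → upper i ≡ b → upper j ≡ c → upper i ≡ upper j
      cases true  true  ui uj = trans ui (sym uj)
      cases true  false ui uj = contradiction (shifted-separates t ui uj) (<-irrefl (≈-sym i≈j))
      cases false true  ui uj = contradiction (shifted-separates t uj ui) (<-irrefl i≈j)
      cases false false ui uj = trans ui (sym uj)

    collide⇒upper-≡ : ∀ {i j t} → Collide v i j t → upper i ≡ upper j
    collide⇒upper-≡ {i} {j} {t} c =
      let k , _ , e = Equivalence.to (collisions i j t) c in upper-closed k e

    collide-shifted : ∀ {i j t} → Collide v i j t → Collide shifted i j t
    collide-shifted {i} {j} {t} c@(i≢j , i≈j) = i≢j ,
      subst (λ b → shifted i t ≈ v j t - offset b t) (collide⇒upper-≡ c) (+-congʳ i≈j)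

    shifted-collide : ∀ {i j t} → Collide shifted i j t → Collide v i j t
    shifted-collide {i} {j} {t} (i≢j , i≈j) with compare (v i t) (v j t)
    ... | tri< i<j _ _  = contradiction
      (shifted-< t (shifted-≈⇒upper-≡ i≈j) i<j) (<-irrefl i≈j)
    ... | tri≈ _ i≈j′ _ = i≢j , i≈j′
    ... | tri> _ _ j<i  = contradiction
      (shifted-< t (sym (shifted-≈⇒upper-≡ i≈j)) j<i) (<-irrefl (≈-sym i≈j))

    -- Within a class all trajectories are shifted alike, and across classes nothing collides before
    -- or after the shift, so collisions and crossings carry over.
    shifted-trajectories : IsTrajectoryFamily shifted
    shifted-trajectories = record
      { continuous    = λ i → sub-continuous (continuous i) (offset-continuous (upper i))
      ; instantaneous = λ i j t c →
          let ε , 0<ε , alone = instantaneous i j t (shifted-collide c)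
          in ε , 0<ε , λ s s~t s≉t c′ → alone s s~t s≉t (shifted-collide c′)
      ; onePair       = λ i j k l t c c′ →
          onePair i j k l t (shifted-collide c) (shifted-collide c′)
      ; crossing      = λ i j t c (ε , 0<ε , before) →
          let eq = collide⇒upper-≡ (shifted-collide c)
              δ , 0<δ , after = crossing i j t (shifted-collide c)
                (ε , 0<ε , λ s t-ε<s s<t → shifted-<⁻ s eq (before s t-ε<s s<t))
          in δ , 0<δ , λ s t<s s<t+δ → shifted-< s (sym eq) (after s t<s s<t+δ)
      }
      where
      offset-continuous : ∀ b → Continuous (offset b)
      offset-continuous true  = lo-continuous
      offset-continuous false = hi-continuous

    shifted-history : HasHistory shifted h
    shifted-history = record
      { time       = time
      ; increasing = increasing
      ; collisions = λ i j t → mk⇔ (Equivalence.to (collisions i j t) ∘ shifted-collide)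
                                   (collide-shifted ∘ Equivalence.from (collisions i j t))
      }

  -- With two objects there is a collision, whose edge lies within one class; with three or more,
  -- two of the first three share a class by the pigeonhole principle.
  sameClass : ∀ {n m} (h : History n m) → ¬ TwoWithoutCollision n m →
    (upper : Fin n → Bool) → (∀ k {i j} → Joins (h k) i j → upper i ≡ upper j) →
    ∀ {i j : Fin n} → i ≢ j → ∃₂ λ a b → a ≢ b × upper a ≡ upper b
  sameClass {suc zero} h _ upper closed {zero} {zero} 0≢0 = contradiction refl 0≢0
  sameClass {suc (suc zero)} {zero}  h ¬two upper closed _ = contradiction (refl , refl) ¬two
  sameClass {suc (suc zero)} {suc m} h _ upper closed _ =
    _ , _ , FinP.<⇒≢ (Edge.lo<hi (h zero)) , closed zero (inj₁ (refl , refl))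
  sameClass {suc (suc (suc n))} h _ upper closed _
    with upper zero in eq₀ | upper (suc zero) in eq₁ | upper (suc (suc zero)) in eq₂
  ... | true  | true  | _     = _ , _ , (λ ()) , trans eq₀ (sym eq₁)
  ... | true  | false | true  = _ , _ , (λ ()) , trans eq₀ (sym eq₂)
  ... | true  | false | false = _ , _ , (λ ()) , trans eq₁ (sym eq₂)
  ... | false | true  | true  = _ , _ , (λ ()) , trans eq₁ (sym eq₂)
  ... | false | true  | false = _ , _ , (λ ()) , trans eq₀ (sym eq₂)
  ... | false | false | _     = _ , _ , (λ ()) , trans eq₀ (sym eq₁)

  -- `S` puts the class `upper` on top and `S′` its complement. Uniqueness would make the two
  -- resulting orderings equal or inverse to each other, and both fail.
  module Rearranged {n m} {h : History n m} (¬two : ¬ TwoWithoutCollision n m)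
    (unique : UniquePositions h) {v : Fin n → R → R}
    (trajectories : IsTrajectoryFamily v) (history : HasHistory v h)
    (lo hi : R → R) (lo-continuous : Continuous lo) (hi-continuous : Continuous hi)
    (lo<v : ∀ i t → lo t < v i t) (v<hi : ∀ i t → v i t < hi t)
    (upper : Fin n → Bool) (upper-closed : ∀ k {i j} → Joins (h k) i j → upper i ≡ upper j)
    {i j : Fin n} (i-upper : upper i ≡ true) (j-lower : upper j ≡ false) where

    private
      module V = Family trajectories history
      module S = Shift trajectories history lo hi lo-continuous hi-continuous lo<v v<hi
        upper upper-closed
      module S′ = Shift trajectories history lo hi lo-continuous hi-continuous lo<v v<hi
        (not ∘ upper) (λ k e → cong not (upper-closed k e))
      module W = Family S.shifted-trajectories S.shifted-history
      module W′ = Family S′.shifted-trajectories S′.shifted-history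

      t : R
      -- The shifted families keep the collision times of `v`, so this time before the first
      -- collision serves all three.
      t = V.τ zero

      order : Permutation′ n
      order = proj₁ W.positions zero

      order′ : Permutation′ n
      order′ = proj₁ W′.positions zero

      order-sorts : Sorts (W.Ahead t) order
      order-sorts = proj₂ W.positions zero t (V.τ∈ zero)

      order′-sorts : Sorts (W′.Ahead t) order′
      order′-sorts = proj₂ W′.positions zero t (V.τ∈ zero)

      -- The objects `i` and `j` lie in different classes, so the two families order them
      -- oppositely.
      same-impossible : ¬ order Perm.≈ order′
      same-impossible eq = W′.Ahead-asym
        (S′.shifted-separates t (cong not j-lower) (cong not i-upper))
        (sorts-≈ {_≺₁_ = W.Ahead t} {W′.Ahead t} W.Ahead-asym
          order order′ order-sorts order′-sorts eq
          (S.shifted-separates t i-upper j-lower))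

      -- Both families order objects of one class as `v` does, whereas inversion would exchange
      -- them.
      swap-impossible : order Perm.≈ reverse ∘ₚ order′ →
        ∀ {a b} → upper a ≡ upper b → ¬ V.Ahead t a b
      swap-impossible eq a~b a<b = V.Ahead-asym a<b (S′.shifted-<⁻ t (cong not (sym a~b))
        (sorts-reverse {_≺₁_ = W.Ahead t} {W′.Ahead t} W.Ahead-asym
          order order′ order-sorts order′-sorts eq
          (S.shifted-< t a~b a<b)))

      reversed-impossible : ¬ order Perm.≈ reverse ∘ₚ order′
      reversed-impossible eq with sameClass h ¬two upper upper-closed {i} {j}
        (λ { refl → contradiction (trans (sym i-upper) j-lower) λ () })
      ... | a , b , a≢b , a~b with V.Ahead? zero a b
      ...   | yes a<b = swap-impossible eq a~b a<b
      ...   | no a≮b  = swap-impossible eq (sym a~b)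
        (V.¬Ahead⇒Ahead a≢b (V.Between-apart (V.τ∈ zero)) a≮b)

    absurd : ⊥
    absurd = Sum.[ (λ eq → same-impossible (eq zero)) , (λ eq → reversed-impossible (eq zero)) ]
      (unique S.shifted S′.shifted S.shifted-trajectories S′.shifted-trajectories
        S.shifted-history S′.shifted-history (proj₁ W.positions) (proj₁ W′.positions)
        (proj₂ W.positions) (proj₂ W′.positions))

  -- If the labels of `i` and `j` differ, the component of `i` is closed under edges and omits `j`,
  -- so it can serve as the class to be moved.
  unique⇒connected : ∀ {n m} {h : History n m} → IsCollisionHistory h →
    ¬ TwoWithoutCollision n m → UniquePositions h → Connected h
  unique⇒connected {n} {m} {h} (v , trajectories , history) ¬two unique i j
    with label i FinP.≟ label j
    where open ComponentLabels (componentLabels h)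
  ... | yes i~j = ComponentLabels.walkable (componentLabels h) i j i~j
  ... | no i≁j  =
    let lo , lo-continuous , lo<v = continuousLowerBound v continuous
        hi , hi-continuous , v<hi = continuousUpperBound v continuous
    in ⊥-elim (Rearranged.absurd ¬two unique trajectories history
         lo hi lo-continuous hi-continuous lo<v v<hi upper upper-closed
         (dec-true (label i FinP.≟ label i) refl)
         (dec-false (label j FinP.≟ label i) (≢-sym i≁j)))
    where
    open ComponentLabels (componentLabels h)
    open IsTrajectoryFamily trajectories using (continuous)

    upper : Fin n → Bool
    upper x = does (label x FinP.≟ label i)

    upper-closed : ∀ k {x y} → Joins (h k) x y → upper x ≡ upper y
    upper-closed k e = cong (λ l → does (l FinP.≟ label i)) (joined k e)

mainTheorem1 : (ℝ : CompleteOrderedField) (n m : ℕ) (h : History n m) →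
    Motion.IsCollisionHistory ℝ h → ¬ TwoWithoutCollision n m →
    Motion.UniquePositions ℝ h ⇔ Connected h
mainTheorem1 ℝ n m h isHistory ¬two =
  mk⇔ (Kinematics.unique⇒connected ℝ isHistory ¬two) (Kinematics.connected⇒unique ℝ)
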